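{- Let $N=n+s+r$ with $N,n\ge1$, let $A_1,\dots,A_m\subseteq\{0,1\}^{n+s}$ and $B_1,\dots,B_\ell\subseteq\{0,1\}^{n+r}$, let $\tilde A_j,\tilde B_j\subseteq\{0,1\}^N$ be their cylinders and let $U,V\subseteq\{0,1\}^n$ be the associated sets (see context). Assume the monotonicity condition: for all $u,u'\in\{0,1\}^n$, $b\in\{0,1\}^s$, if $(u,b)\in\bigcap_{j\le m}A_j$ and $u'\ge u$ then $(u',b)\in\bigcap_{j\le m}A_j$. Let $e\ge1$, $\epsilon>0$ and let $(C_{\mathbf r})_{\mathbf r}$, $C_{\mathbf r}=(C^1_{\mathbf r},\dots,C^e_{\mathbf r})$, be a random distribution on $e$-tuples of subsets of $\{0,1\}^N$ such that $\left(\bigcap_{i\le e}C^i_{\mathbf r}\right)_{\mathbf r}$ is an $\epsilon$-approximation of $\{0,1\}^N$. Assume that for all samples $\mathbf r$ there is a semantic refutation $\pi_{\mathbf r}$ of $$\tilde A_1,\dots,\tilde A_m,\tilde B_1,\dots,\tilde B_\ell,C^1_{\mathbf r},\dots,C^e_{\mathbf r}$$ with $k$ lines, such that the monotone communication complexity (w.r.t. $U$) of all sets in $\pi_{\mathbf r}$ is at most $t$. Then there is a randomized protocol for $KW^m[U,V]$ of size at most $k+n+e$ and also at most $2k+n$, of communication complexity $O(t)$ and of error at most $\epsilon$. Moreover, if the refutations $\pi_{\mathbf r}$ are tree-like then also the randomized protocol is tree-like.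
   Context: $O(\cdot)$ hides an absolute constant. Set-up. $\tilde A:=\{(a,b,c): (a,b)\in A,\ c\in\{0,1\}^r\}$ for $A\subseteq\{0,1\}^{n+s}$ and $\tilde B:=\{(a,b,c): (a,c)\in B,\ b\in\{0,1\}^s\}$ for $B\subseteq\{0,1\}^{n+r}$, where $a\in\{0,1\}^n$. $U=\{u\in\{0,1\}^n:\exists b\in\{0,1\}^s,\ (u,b)\in\bigcap_{j\le m}A_j\}$, $V=\{v\in\{0,1\}^n:\exists c\in\{0,1\}^r,\ (v,c)\in\bigcap_{j\le\ell}B_j\}$. The order $\le$ on $\{0,1\}^n$ is coordinatewise. $U$ and $V$ are assumed disjoint (so that $KW^m[U,V]$ is defined). Semantic refutation. A sequence $D_1,\dots,D_k\subseteq\{0,1\}^N$ is a semantic refutation (with $k$ lines) of given sets $E_1,\dots,E_p\subseteq\{0,1\}^N$ if each $D_i$ is either one of the $E_j$ or contains $D_{j_1}\cap D_{j_2}$ for some $j_1,j_2<i$, and $D_k=\emptyset$. It is tree-like if each $D_i$ is used at most once as a premise. Monotone communication complexity of a set. For $D\subseteq\{0,1\}^N$, $u,v\in\{0,1\}^n$, $q^u\in\{0,1\}^s$, $r^v\in\{0,1\}^r$ consider the tasks: (1) decide whether $(u,q^u,r^v)\in D$; (2) decide whether $(v,q^u,r^v)\in D$; (3) if exactly one of $(u,q^u,r^v),(v,q^u,r^v)$ is in $D$, find $i\le n$ with $u_i\ne v_i$; (4) if $(u,q^u,r^v)\in D$ and $(v,q^u,r^v)\notin D$, either find $i\le n$ with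 $u_i=1\wedge v_i=0$, or decide that there is $u'\ge u$ with $(u',q^u,r^v)\notin D$. $CC(D)$ is the minimal $t$ such that tasks (1)–(3) can be solved by two players, one knowing $u,q^u$ and the other $v,r^v$, exchanging at most $t$ bits. The monotone communication complexity w.r.t. $U$, $MCC_U(D)$, is the minimal $t\ge CC(D)$ such that also task (4) can be solved by exchanging at most $t$ bits. Approximation. A random distribution $(Y_{\mathbf r})_{\mathbf r}$ on subsets of $\{0,1\}^N$ is an $\epsilon$-approximation of $X\subseteq\{0,1\}^N$ if for all $w\in\{0,1\}^N$, $\mathrm{Prob}_{\mathbf r}[w\in X\triangle Y_{\mathbf r}]\le\epsilon$. $KW^m[U,V]$ (for disjoint $U,V$ with $U$ closed upwards) is the multi-function on $U\times V$ with values in $[n]$ whose valid values at $(u,v)$ are all $i$ with $u_i=1\wedge v_i=0$. Protocols. For a multi-function $R\subseteq U\times V\times I$ consider 4-tuples $\mathbf P=(G,\mathsf{lab},F,S)$: (P1) $G$ is a directed acyclic graph with one source, the root $\emptyset$; (P2) nodes of out-degree $0$ (leaves) are labelled by $\mathsf{lab}$ by elements of $I$; (P3) $S(u,v,x)$ assigns to a non-leaf node $x$ and $(u,v)\in U\times V$ a node reachable by an edge from $x$; (P4a) for every $(u,v)$, $F(u,v)$ is a set of nodes of $G$ with $\emptyset\in F(u,v)$. Size of $\mathbf P$: number of nodes of $G$. $CC(\mathbf P)$: the minimal $t$ such that for every node $x$ two players, one knowing $u,x$ and the other $v,x$, can decide $x\in F(u,v)$, and compute $S(u,v,x)$, each by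 exchanging at most $t$ bits. A randomized protocol for $R$ with error $\epsilon$ is a random variable $(\mathbf P_{\mathbf r})_{\mathbf r}$ of such 4-tuples such that for every $(u,v)\in U\times V$: (P4b') $\mathrm{Prob}_{\mathbf r}[\exists x,\ x\in F_{\mathbf r}(u,v)\wedge S_{\mathbf r}(u,v,x)\notin F_{\mathbf r}(u,v)]\le\epsilon$, and (P4c') $\mathrm{Prob}_{\mathbf r}[\exists\text{ leaf }x\in F_{\mathbf r}(u,v),\ \mathsf{lab}_{\mathbf r}(x)=i\wedge\neg R(u,v,i)]\le\epsilon$. Its size and communication complexity are the maxima over $\mathbf r$; it is tree-like if each $G_{\mathbf r}$ is a tree.
   Formalization: For tree-like refutations, the protocol within the stated size bounds is a tree only up to sharing of leaves; a protocol whose graphs are literally trees is given with size at most k+kn. A literal tree within the stated size bounds and communication O(t) does not exist in general. -}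

module Defs where

open import Algebra.Bundles using (CommutativeRing)
import Algebra.Properties.Monoid.Sum as MonoidSum
open import Data.Bool using (Bool; true; false; not; _∧_; _xor_; if_then_else_)
import Data.Bool as Bool
open import Data.Empty using (⊥)
open import Data.Fin using (Fin; toℕ)
import Data.Fin as Fin
open import Data.Fin.Properties using (any?; all?)
open import Data.Nat using (ℕ; zero; suc; _+_; _≤_; _⊔_)
open import Data.Product using (Σ; ∃; ∃₂; _×_; _,_; uncurry)
open import Data.Sum using (_⊎_; inj₁; inj₂; [_,_])
open import Data.Unit using (⊤)
open import Data.Vec using (Vec; lookup; take; drop; _++_)
open import Data.Vec.Functional using (Vector; foldr)
open import Level using (Level; 0ℓ)
import Level
open import Relation.Binary using (Rel; IsPartialOrder)
open import Relation.Binary.Construct.Closure.Transitive using (TransClosure)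
open import Relation.Binary.PropositionalEquality using (_≡_; _≢_; _≗_)
open import Relation.Nullary using (¬_; Dec; does; ¬?; _×-dec_)
open import Relation.Unary using (Pred; Decidable)

------------------------------------------------------------------------
-- The Boolean cube and its subsets

Cube : ℕ → Set
Cube n = Vec Bool n

Subset : ℕ → Set
Subset N = Cube N → Bool

infix 4 _∈_ _∉_ _⊑_

_∈_ _∉_ : ∀ {N} → Cube N → Subset N → Set
w ∈ D = D w ≡ true
w ∉ D = D w ≡ false

full : ∀ {N} → Subset N
full _ = true

_△_ : ∀ {N} → Subset N → Subset N → Subset N
(D △ E) w = D w xor E w

⋂ : ∀ {N p} → Vector (Subset N) p → Subset N
⋂ Ds w = foldr (λ D b → D w ∧ b) true Ds

_⊑_ : ∀ {n} → Rel (Cube n) 0ℓ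
u ⊑ u′ = ∀ i → lookup u i Bool.≤ lookup u′ i

-- {0,1}^(n+s+r) consists of the words (a ++ b) ++ c with |a| = n, |b| = s and
-- |c| = r.

cylA : ∀ n s r → Subset (n + s) → Subset (n + s + r)
cylA n s r A w = A (take (n + s) w)

cylB : ∀ n s r → Subset (n + r) → Subset (n + s + r)
cylB n s r B w = B (take n (take (n + s) w) ++ drop (n + s) w)

-- The set U is Proj s A, and V is Proj r B.

Proj : ∀ {n} s {m} → Vector (Subset (n + s)) m → Pred (Cube n) 0ℓ
Proj s As u = ∃ λ (b : Cube s) → (u ++ b) ∈ ⋂ As

------------------------------------------------------------------------
-- Semantic refutations

record Refutation {N p} (E : Vector (Subset N) p) (k : ℕ) : Set where
  field
    line : Vector (Subset N) k

  Initial : Fin k → Set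
  Initial i = ∃ λ j → line i ≗ E j

  Derived : Fin k → Set
  Derived i = ∃₂ λ j₁ j₂ → j₁ Fin.< i × j₂ Fin.< i ×
                (∀ w → w ∈ line j₁ → w ∈ line j₂ → w ∈ line i)

  field
    just  : ∀ i → Initial i ⊎ Derived i
    empty : ∃ λ z → suc (toℕ z) ≡ k × (∀ w → w ∉ line z)

  PremiseOf : Fin k → Fin k → Set
  PremiseOf j i with just i
  ... | inj₁ _             = ⊥
  ... | inj₂ (j₁ , j₂ , _) = j ≡ j₁ ⊎ j ≡ j₂

  -- A step with j₁ = j₂ uses that line once.
  TreeLike : Set
  TreeLike = ∀ j i i′ → PremiseOf j i → PremiseOf j i′ → i ≡ i′

------------------------------------------------------------------------
-- Two-party communication

data Comm (X Y O : Set) : Set where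
  answer : O → Comm X Y O
  alice  : (X → Bool) → (Bool → Comm X Y O) → Comm X Y O
  bob    : (Y → Bool) → (Bool → Comm X Y O) → Comm X Y O

run : ∀ {X Y O} → Comm X Y O → X → Y → O
run (answer o)  x y = o
run (alice f p) x y = run (p (f x)) x y
run (bob   g p) x y = run (p (g y)) x y

bits : ∀ {X Y O} → Comm X Y O → ℕ
bits (answer _)  = 0
bits (alice _ p) = suc (bits (p false) ⊔ bits (p true))
bits (bob   _ p) = suc (bits (p false) ⊔ bits (p true))

Solvable : ∀ {X Y O : Set} → ℕ → (X → Y → O → Set) → Set
Solvable t Task = ∃ λ Π → bits Π ≤ t × (∀ x y → Task x y (run Π x y))

module _ (n s r : ℕ) (D : Subset (n + s + r)) where

  private
    Alice Bob : Set
    Alice = Cube n × Cube s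
    Bob   = Cube n × Cube r

  DecideU DecideV : Alice → Bob → Bool → Set
  DecideU (u , q) (v , p) o = o ≡ D ((u ++ q) ++ p)
  DecideV (u , q) (v , p) o = o ≡ D ((v ++ q) ++ p)

  FindDifference : Alice → Bob → Fin n → Set
  FindDifference (u , q) (v , p) i =
    D ((u ++ q) ++ p) ≢ D ((v ++ q) ++ p) → lookup u i ≢ lookup v i

  FindOrRaise : Alice → Bob → Fin n ⊎ ⊤ → Set
  FindOrRaise (u , q) (v , p) o =
    ((u ++ q) ++ p) ∈ D → ((v ++ q) ++ p) ∉ D →
    [ (λ i → lookup u i ≡ true × lookup v i ≡ false)
    , (λ _ → ∃ λ u′ → u ⊑ u′ × ((u′ ++ q) ++ p) ∉ D)
    ] o

  -- CC≤ t and MCC≤ t assert that CC(D), respectively MCC_U(D), is at most t.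
  -- The tasks do not mention U, hence neither does MCC≤.

  CC≤ : ℕ → Set
  CC≤ t = Solvable t DecideU × Solvable t DecideV × Solvable t FindDifference

  MCC≤ : ℕ → Set
  MCC≤ t = CC≤ t × Solvable t FindOrRaise

------------------------------------------------------------------------
-- Finite probability spaces

-- Probabilities are elements of an arbitrary partially ordered commutative
-- ring, so that both rational and real probabilities are covered.

record OrderedRing c ℓ₁ ℓ₂ : Set (Level.suc (c Level.⊔ ℓ₁ Level.⊔ ℓ₂)) where
  field
    commutativeRing : CommutativeRing c ℓ₁
  open CommutativeRing commutativeRing public
    using (Carrier; _≈_; 0#; 1#; +-monoid) renaming (_+_ to _⊕_; _*_ to _⊗_)
  field
    _≼_            : Rel Carrier ℓ₂
    isPartialOrder : IsPartialOrder _≈_ _≼_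
    ⊕-mono-≼       : ∀ {w x y z} → w ≼ x → y ≼ z → (w ⊕ y) ≼ (x ⊕ z)
    ⊗-nonNegative  : ∀ {x y} → 0# ≼ x → 0# ≼ y → 0# ≼ (x ⊗ y)

  _≺_ : Rel Carrier (ℓ₁ Level.⊔ ℓ₂)
  x ≺ y = x ≼ y × ¬ (x ≈ y)

  open MonoidSum +-monoid public using (sum)

module _ {c ℓ₁ ℓ₂} (K : OrderedRing c ℓ₁ ℓ₂) where
  open OrderedRing K

  record ProbabilitySpace : Set (c Level.⊔ ℓ₁ Level.⊔ ℓ₂) where
    field
      outcomes    : ℕ
      weight      : Fin outcomes → Carrier
      nonNegative : ∀ ω → 0# ≼ weight ω
      total       : sum weight ≈ 1#

    Ω : Set
    Ω = Fin outcomes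

    Prob : ∀ {ℓ} {Event : Pred Ω ℓ} → Decidable Event → Carrier
    Prob Event? = sum (λ ω → if does (Event? ω) then weight ω else 0#)

  module _ (𝒮 : ProbabilitySpace) where
    open ProbabilitySpace 𝒮

    Approximates : ∀ {N} → Carrier → (Ω → Subset N) → Subset N → Set ℓ₂
    Approximates ε Y X =
      ∀ w → Prob {Event = λ ω → w ∈ (X △ Y ω)} (λ ω → (X △ Y ω) w Bool.≟ true) ≼ ε

------------------------------------------------------------------------
-- Protocols

-- F, S and lab are total functions: their values outside U × V, the values of S
-- at leaves and the labels of inner nodes carry no meaning, and no condition
-- below refers to them.

record Protocol {X Y : Set} (U : Pred X 0ℓ) (V : Pred Y 0ℓ) (I : Set) : Set where
  field
    size : ℕ
    edge : Fin size → Fin size → Bool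

  Node : Set
  Node = Fin size

  Edge : Rel Node 0ℓ
  Edge x y = edge x y ≡ true

  Leaf : Pred Node 0ℓ
  Leaf x = ∀ y → ¬ Edge x y

  Leaf? : Decidable Leaf
  Leaf? x = all? (λ y → ¬? (edge x y Bool.≟ true))

  field
    acyclic     : ∀ x → ¬ TransClosure Edge x x
    root        : Node
    root-source : ∀ x → ¬ Edge x root
    root-unique : ∀ x → (∀ y → ¬ Edge y x) → x ≡ root
    lab         : Node → I
    S           : X → Y → Node → Node
    S-edge      : ∀ {u v} → U u → V v → ∀ x → ¬ Leaf x → Edge x (S u v x)
    F           : X → Y → Node → Bool
    root∈F      : ∀ {u v} → U u → V v → F u v root ≡ true

  Comm≤ : ℕ → Set
  Comm≤ t = ∀ x →
    Solvable t (λ u v o → U u → V v → o ≡ F u v x) ×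
    (¬ Leaf x → Solvable t (λ u v o → U u → V v → o ≡ S u v x))

  Tree : Set
  Tree = ∀ x y z → Edge y x → Edge z x → y ≡ z

  -- G becomes a tree once every leaf is replaced by one copy for each of its
  -- incoming edges.  Size bounds that contain only n answer leaves in total, one
  -- for each i in [n], require this sharing: with a Tree the answer leaves have
  -- to be repeated below different nodes.
  TreeUpToLeaves : Set
  TreeUpToLeaves = ∀ x → ¬ Leaf x → ∀ y z → Edge y x → Edge z x → y ≡ z

  StrategyFails : X → Y → Set
  StrategyFails u v =
    ∃ λ x → ¬ Leaf x × F u v x ≡ true × F u v (S u v x) ≡ false

  strategyFails? : ∀ u v → Dec (StrategyFails u v)
  strategyFails? u v = any? λ x →
    ¬? (Leaf? x) ×-dec (F u v x Bool.≟ true) ×-dec (F u v (S u v x) Bool.≟ false)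

  LabelWrong : (X → Y → I → Bool) → X → Y → Set
  LabelWrong R u v = ∃ λ x → Leaf x × F u v x ≡ true × R u v (lab x) ≡ false

  labelWrong? : ∀ R u v → Dec (LabelWrong R u v)
  labelWrong? R u v = any? λ x →
    Leaf? x ×-dec (F u v x Bool.≟ true) ×-dec (R u v (lab x) Bool.≟ false)

record RandomizedProtocol {c ℓ₁ ℓ₂} (K : OrderedRing c ℓ₁ ℓ₂)
                          {X Y : Set} (U : Pred X 0ℓ) (V : Pred Y 0ℓ) (I : Set)
                          : Set (c Level.⊔ ℓ₁ Level.⊔ ℓ₂) where
  open OrderedRing K
  field
    space : ProbabilitySpace K
  open ProbabilitySpace space public
  field
    sample : Ω → Protocol U V I

  Size≤ : ℕ → Set
  Size≤ b = ∀ ω → Protocol.size (sample ω) ≤ b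

  Communication≤ : ℕ → Set
  Communication≤ t = ∀ ω → Protocol.Comm≤ (sample ω) t

  Error≤ : (X → Y → I → Bool) → Carrier → Set ℓ₂
  Error≤ R ε = ∀ {u v} → U u → V v →
    Prob (λ ω → Protocol.strategyFails? (sample ω) u v) ≼ ε ×
    Prob (λ ω → Protocol.labelWrong? (sample ω) R u v) ≼ ε

  AllTree AllTreeUpToLeaves : Set
  AllTree           = ∀ ω → Protocol.Tree (sample ω)
  AllTreeUpToLeaves = ∀ ω → Protocol.TreeUpToLeaves (sample ω)

KWᵐ : ∀ {n} → Cube n → Cube n → Fin n → Bool
KWᵐ u v i = lookup u i ∧ not (lookup v i)

{-# OPTIONS --safe #-}

-- Fix q with (u , q u) ∈ ⋂ A for u ∈ U, and p with (v , p v) ∈ ⋂ B for v ∈ V,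
-- and let w u v = (v , q u , p v).  The protocol walks down the refutation from
-- its empty last line, staying at lines that do not contain w u v: at a derived
-- line some premise misses w u v.  A missed initial line is some Ã j or some
-- C j.  In the first case it contains (u′ , q u , p v) for all u′ ⊒ u by
-- monotonicity, so that task (4) must output a valid answer; the second case is
-- covered by the error ε.

module Submission where

open import Defs
open import Data.Bool using (Bool; true; false; not; _∧_; if_then_else_)
import Data.Bool as Bool
open import Data.Bool.Properties using (∧-zeroʳ; ¬-not; not-injective)
open import Data.Empty using (⊥)
open import Data.Fin using (Fin; zero; suc; toℕ; splitAt; join; combine; remainder; fromℕ<)
import Data.Fin as Fin
open import Data.Fin.Induction using (<-wellFounded)
open import Data.Fin.Properties using
  (any?; toℕ<n; toℕ-injective; splitAt-join; join-splitAt; remQuot-combine;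
   combine-surjective; combine-injectiveˡ)
open import Data.Nat using (ℕ; zero; suc; _+_; _*_; _≤_; _<_; _⊔_; z≤n; s≤s)
import Data.Nat.Properties as ℕ
open import Data.Product using (Σ; ∃; ∃₂; _×_; _,_; proj₁; proj₂)
open import Data.Sum using (_⊎_; inj₁; inj₂; [_,_])
open import Data.Sum.Properties using (≡-dec)
open import Data.Unit using (⊤)
open import Data.Vec using (Vec; []; _∷_; _++_; lookup; take; drop; replicate)
open import Data.Vec.Functional using (Vector) renaming (_++_ to _⧺_)
open import Data.Vec.Properties using (take++drop≡id; ++-injective)
open import Function using (id; const; _∘_)
open import Induction.WellFounded using (Acc; acc)
open import Level using (0ℓ)
open import Relation.Binary using (IsPartialOrder)
open import Relation.Binary.Construct.Closure.Transitive using (TransClosure; _∷_)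
  renaming ([_] to edge⁺)
open import Relation.Binary.PropositionalEquality using
  (_≡_; _≢_; refl; sym; trans; cong; cong₂; subst)
open import Relation.Nullary using (¬_; Dec; yes; no; does; ¬?; _×-dec_; _⊎-dec_; contradiction)
open import Relation.Nullary.Decidable using (dec-true)
open import Relation.Unary using (Pred; Decidable)

does-true : ∀ {a} {P : Set a} (P? : Dec P) → does P? ≡ true → P
does-true (yes p) _ = p

∈⇒¬∉ : ∀ {N} {D : Subset N} {w} → w ∈ D → ¬ w ∉ D
∈⇒¬∉ w∈D w∉D with () ← trans (sym w∈D) w∉D

-- Cubes and their subsets

take-++ : ∀ {a} {X : Set a} {m n} (xs : Vec X m) (ys : Vec X n) → take m (xs ++ ys) ≡ xs
take-++ {m = m} xs ys = proj₁ (++-injective (take m (xs ++ ys)) xs (take++drop≡id m (xs ++ ys)))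

drop-++ : ∀ {a} {X : Set a} {m n} (xs : Vec X m) (ys : Vec X n) → drop m (xs ++ ys) ≡ ys
drop-++ {m = m} xs ys = proj₂ (++-injective (take m (xs ++ ys)) xs (take++drop≡id m (xs ++ ys)))

cylA-++ : ∀ {n s r} (A : Subset (n + s)) (a : Cube n) (b : Cube s) (c : Cube r) →
          cylA n s r A ((a ++ b) ++ c) ≡ A (a ++ b)
cylA-++ A a b c = cong A (take-++ (a ++ b) c)

cylB-++ : ∀ {n s r} (B : Subset (n + r)) (a : Cube n) (b : Cube s) (c : Cube r) →
          cylB n s r B ((a ++ b) ++ c) ≡ B (a ++ c)
cylB-++ {n} B a b c = cong B (cong₂ _++_
  (trans (cong (take n) (take-++ (a ++ b) c)) (take-++ a b))
  (drop-++ (a ++ b) c))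

⋂-∉ : ∀ {N p} {Ds : Vector (Subset N) p} {w} j → w ∉ Ds j → w ∉ ⋂ Ds
⋂-∉ zero    w∉ rewrite w∉ = refl
⋂-∉ {Ds = Ds} {w} (suc j) w∉ =
  trans (cong (Ds zero w ∧_) (⋂-∉ {Ds = Ds ∘ suc} j w∉)) (∧-zeroʳ (Ds zero w))

⋂-∈ : ∀ {N p} {Ds : Vector (Subset N) p} {w} → w ∈ ⋂ Ds → ∀ j → w ∈ Ds j
⋂-∈ {Ds = Ds} {w} w∈ j = ¬-not λ w∉ → ∈⇒¬∉ {D = ⋂ Ds} w∈ (⋂-∉ {Ds = Ds} j w∉)

⊑-refl : ∀ {n} (u : Cube n) → u ⊑ u
⊑-refl u i with lookup u i
... | false = Bool.b≤b
... | true  = Bool.b≤b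

-- A search that prefers `true`. It is total: an empty `D` yields the all-`false` word, so no
-- membership proof is needed to name the choice.
choose : ∀ {s} → Subset s → Cube s
choose {zero}  D = []
choose {suc s} D = if D (true ∷ b) then true ∷ b else false ∷ choose (D ∘ (false ∷_))
  where b = choose (D ∘ (true ∷_))

choose-∈ : ∀ {s} (D : Subset s) → ∃ (_∈ D) → choose D ∈ D
choose-∈ {zero}  D ([] , b∈D) = b∈D
choose-∈ {suc s} D (b , b∈D) with D (true ∷ choose (D ∘ (true ∷_))) in eq
choose-∈ {suc s} D (b         , b∈D) | true  = eq
-- A member starting with `true` would, by induction, make the inner choice a member as well, so the
-- test could not have failed.
choose-∈ {suc s} D (true  ∷ b , b∈D) | false =
  contradiction eq (∈⇒¬∉ {D = D} (choose-∈ (D ∘ (true ∷_)) (b , b∈D)))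
choose-∈ {suc s} D (false ∷ b , b∈D) | false = choose-∈ (D ∘ (false ∷_)) (b , b∈D)

-- The choice depends on `u` alone, so a player who knows `u` finds it without communication.
extension : ∀ {n s m} → Vector (Subset (n + s)) m → Cube n → Cube s
extension As u = choose (λ b → ⋂ As (u ++ b))

extension-∈ : ∀ {n s m} (As : Vector (Subset (n + s)) m) {u : Cube n} →
              Proj s As u → (u ++ extension As u) ∈ ⋂ As
extension-∈ As = choose-∈ _

-- Communication

module _ {X X′ Y Y′ O O′ : Set} (f : X′ → X) (g : Y′ → Y) (h : O → O′) where

  -- Each player translates the own input locally by `f` or `g`, and both can apply `h` to the
  -- outcome; none of this costs a bit.
  mapComm : Comm X Y O → Comm X′ Y′ O′
  mapComm (answer o)  = answer (h o)
  mapComm (alice b Π) = alice (b ∘ f) (λ c → mapComm (Π c))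
  mapComm (bob b Π)   = bob (b ∘ g) (λ c → mapComm (Π c))

  run-mapComm : ∀ Π x y → run (mapComm Π) x y ≡ h (run Π (f x) (g y))
  run-mapComm (answer o)  x y = refl
  run-mapComm (alice b Π) x y = run-mapComm (Π (b (f x))) x y
  run-mapComm (bob b Π)   x y = run-mapComm (Π (b (g y))) x y

  bits-mapComm : ∀ Π → bits (mapComm Π) ≡ bits Π
  bits-mapComm (answer o)  = refl
  bits-mapComm (alice b Π) = cong suc (cong₂ _⊔_ (bits-mapComm (Π false)) (bits-mapComm (Π true)))
  bits-mapComm (bob b Π)   = cong suc (cong₂ _⊔_ (bits-mapComm (Π false)) (bits-mapComm (Π true)))

run-silent : ∀ {X Y O} (Π : Comm X Y O) → bits Π ≤ 0 → ∀ x y x′ y′ → run Π x y ≡ run Π x′ y′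
run-silent (answer o) _ x y x′ y′ = refl

-- Semantic refutations

module Lines {N p} {E : Vector (Subset N) p} {k} (ρ : Refutation E k) where
  open Refutation ρ

  last : Fin k
  last = proj₁ empty

  ≤-last : ∀ i → toℕ i ≤ toℕ last
  ≤-last i = ℕ.≤-pred (subst (toℕ i <_) (sym (proj₁ (proj₂ empty))) (toℕ<n i))

  last-∉ : ∀ w → w ∉ line last
  last-∉ w = proj₂ (proj₂ empty) w

  PremiseOf? : ∀ j i → Dec (PremiseOf j i)
  PremiseOf? j i with just i
  ... | inj₁ _              = no λ ()
  ... | inj₂ (j₁ , j₂ , _) = (j Fin.≟ j₁) ⊎-dec (j Fin.≟ j₂)

  premise⇒< : ∀ {j i} → PremiseOf j i → j Fin.< i
  premise⇒< {j} {i} premise with just i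
  premise⇒< (inj₁ refl) | inj₂ (_ , _ , j₁<i , _) = j₁<i
  premise⇒< (inj₂ refl) | inj₂ (_ , _ , _ , j₂<i , _) = j₂<i

  -- `PremiseOf` is defined by matching on `just i`, so it unfolds only once an equation for
  -- `just i` is matched.
  premise₁ : ∀ {i j₁ j₂ rest} → just i ≡ inj₂ (j₁ , j₂ , rest) → PremiseOf j₁ i
  premise₁ {i} eq with just i | eq
  ... | _ | refl = inj₁ refl

  premise₂ : ∀ {i j₁ j₂ rest} → just i ≡ inj₂ (j₁ , j₂ , rest) → PremiseOf j₂ i
  premise₂ {i} eq with just i | eq
  ... | _ | refl = inj₂ refl

  -- Descending through missed premises from the empty line can end only at an initial line. This
  -- serves the case `t ≡ 0`, where no walk is built into the protocol.
  missed-initial : ∀ w → ∃ λ i → Initial i × w ∉ line i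
  missed-initial w = descend last (<-wellFounded last) (last-∉ w)
    where
    descend : ∀ i → Acc Fin._<_ i → w ∉ line i → ∃ λ i → Initial i × w ∉ line i
    descend i (acc below) w∉i with just i
    ... | inj₁ initial = i , initial , w∉i
    ... | inj₂ (j₁ , j₂ , j₁<i , j₂<i , sound) with line j₁ w in eq₁ | line j₂ w in eq₂
    ... | false | _     = descend j₁ (below j₁<i) eq₁
    ... | true  | false = descend j₂ (below j₂<i) eq₂
    ... | true  | true  = contradiction w∉i (∈⇒¬∉ {D = line i} (sound w eq₁ eq₂))

  -- Unused lines are attached to the last line, which makes it the only source.
  LineEdge : Fin k → Fin k → Set
  LineEdge x y = PremiseOf y x ⊎ (x ≡ last × y ≢ last × ¬ ∃ (PremiseOf y))

  LineEdge? : ∀ x y → Dec (LineEdge x y)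
  LineEdge? x y = PremiseOf? y x ⊎-dec
    ((x Fin.≟ last) ×-dec ¬? (y Fin.≟ last) ×-dec ¬? (any? (PremiseOf? y)))

  lineEdge⇒> : ∀ {x y} → LineEdge x y → toℕ y < toℕ x
  lineEdge⇒> (inj₁ premise)             = premise⇒< premise
  lineEdge⇒> {y = y} (inj₂ (refl , y≢last , _)) = ℕ.≤∧≢⇒< (≤-last y) (y≢last ∘ toℕ-injective)

  lineEdge-into : ∀ {y} → y ≢ last → ∃ λ x → LineEdge x y
  lineEdge-into {y} y≢last with any? (PremiseOf? y)
  ... | yes (x , premise) = x , inj₁ premise
  ... | no  unused        = last , inj₂ (refl , y≢last , unused)

  lineEdge-unique : TreeLike → ∀ {x x′ y} → LineEdge x y → LineEdge x′ y → x ≡ x′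
  lineEdge-unique tree (inj₁ p) (inj₁ p′) = tree _ _ _ p p′
  lineEdge-unique tree (inj₁ p) (inj₂ (_ , _ , unused)) = contradiction (_ , p) unused
  lineEdge-unique tree (inj₂ (_ , _ , unused)) (inj₁ p) = contradiction (_ , p) unused
  lineEdge-unique tree (inj₂ (refl , _)) (inj₂ (refl , _)) = refl

-- The protocols of a single refutation

module Interpolation
  {n s r m ℓ e k : ℕ} (A : Vector (Subset (n + s)) m) (B : Vector (Subset (n + r)) ℓ)
  (monotone : (u u′ : Cube n) (b : Cube s) → (u ++ b) ∈ ⋂ A → u ⊑ u′ → (u′ ++ b) ∈ ⋂ A)
  (C : Vector (Subset (n + s + r)) e)
  (ρ : Refutation ((λ j → cylA n s r (A j)) ⧺ ((λ j → cylB n s r (B j)) ⧺ C)) k)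
  (t : ℕ) (mcc : ∀ i → MCC≤ n s r (Refutation.line ρ i) t)
  (i₀ : Fin n)
  where

  open Refutation ρ
  open Lines ρ

  U V : Pred (Cube n) 0ℓ
  U = Proj s A
  V = Proj r B

  q : Cube n → Cube s
  q = extension A

  p : Cube n → Cube r
  p = extension B

  withQ : Cube n → Cube n × Cube s
  withQ u = u , q u

  withP : Cube n → Cube n × Cube r
  withP v = v , p v

  w : Cube n → Cube n → Cube (n + s + r)
  w u v = (v ++ q u) ++ p v

  -- This rules out the second outcome of task (4); taking `u′` to be `u` gives its first premise.
  AboveIn : Subset (n + s + r) → Cube n → Cube n → Set
  AboveIn D u v = ∀ u′ → u ⊑ u′ → ((u′ ++ q u) ++ p v) ∈ D

  -- The first alternative is the monotone case of some `A j`. Cylinders of `B j` contain `w u v`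
  -- outright, since they see only `v` and `p v`, and share the second alternative with the `C j`.
  initial-cases : ∀ {u v i} → U u → V v → Initial i →
    AboveIn (line i) u v ⊎ (w u v ∈ ⋂ C → w u v ∈ line i)
  initial-cases {u} {v} Uu Vv (j , line≗) with splitAt m j
  ... | inj₁ jA = inj₁ λ u′ u⊑u′ → trans (line≗ _) (trans (cylA-++ (A jA) u′ (q u) (p v))
          (⋂-∈ {Ds = A} (monotone u u′ (q u) (extension-∈ A Uu) u⊑u′) jA))
  ... | inj₂ j′ with splitAt ℓ j′
  ... | inj₁ jB = inj₂ λ _ → trans (line≗ _) (trans (cylB-++ (B jB) v (q u) (p v))
          (⋂-∈ {Ds = B} (extension-∈ B Vv) jB))
  ... | inj₂ jC = inj₂ λ w∈C → trans (line≗ _) (⋂-∈ {Ds = C} w∈C jC)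

  decideV : ∀ i → Solvable t (DecideV n s r (line i))
  decideV i = proj₁ (proj₂ (proj₁ (mcc i)))

  findOrRaise : ∀ i → Solvable t (FindOrRaise n s r (line i))
  findOrRaise i = proj₂ (mcc i)

  -- For t = 0 the two bits that test an answer leaf are not available.  But then
  -- all lines are ∅ or the whole cube, so a missed initial line must be some C j,
  -- and any protocol is as good as it needs to be.
  silent⇒∉ : t ≡ 0 → ∀ {u v} → U u → V v → w u v ∉ ⋂ C
  silent⇒∉ refl {u} {v} Uu Vv with i , initial , w∉i ← missed-initial (w u v)
                              with initial-cases Uu Vv initial
  ... | inj₂ ∈C⇒∈i = ¬-not λ w∈C → ∈⇒¬∉ {D = line i} (∈C⇒∈i w∈C) w∉i
  -- A silent verdict ignores Bob's input. Replacing `(v , p v)` by `(u , p v)` turns it into a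
  -- verdict on a point that `above` puts into the line, against `w∉i`.
  ... | inj₁ above with Π , silent , correct ← decideV i =
    contradiction (trans (trans (sym (correct x y)) (run-silent Π silent x y x (v , p v)))
                         (trans (correct x (v , p v)) w∉i))
                  (∈⇒¬∉ {D = line i} (above u (⊑-refl u)))
    where
    x = u , q u
    y = u , p v

  -- The only node is root and leaf at once. As `F` always holds the strategy cannot fail, and a
  -- wrong label `i₀` is charged to the error through `silent⇒∉`.
  trivialProtocol : Protocol U V (Fin n)
  trivialProtocol = record
    { size        = 1
    ; edge        = λ _ _ → false
    ; acyclic     = λ { _ (edge⁺ ()) ; _ (() ∷ _) }
    ; root        = zero
    ; root-source = λ _ ()
    ; root-unique = λ { zero _ → refl }
    ; lab         = λ _ → i₀
    ; S           = λ _ _ x → x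
    ; S-edge      = λ _ _ _ inner → contradiction (λ _ ()) inner
    ; F           = λ _ _ _ → true
    ; root∈F      = λ _ _ → refl
    }

  trivial-Comm≤ : ∀ {b} → Protocol.Comm≤ trivialProtocol b
  trivial-Comm≤ x = (answer true , z≤n , λ _ _ _ _ → refl)
                  , λ _ → answer x , z≤n , λ _ _ _ _ → refl

  -- A line x is joined to the answer leaves at x i, with label i.

  module Walk {L : ℕ} (at : Fin k → Fin n → Fin L) (label : Fin L → Fin n)
    (label-at : ∀ x i → label (at x i) ≡ i) (at-surjective : ∀ a → ∃₂ λ x i → at x i ≡ a)
    where

    Place : Set
    Place = Fin L ⊎ Fin k

    place : Fin (L + k) → Place
    place = splitAt L

    place-injective : ∀ {x y} → place x ≡ place y → x ≡ y
    place-injective {x} {y} eq =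
      trans (sym (join-splitAt L k x)) (trans (cong (join L k) eq) (join-splitAt L k y))

    Link : Place → Place → Set
    Link (inj₁ _) _        = ⊥
    Link (inj₂ x) (inj₁ a) = ∃ λ i → at x i ≡ a
    Link (inj₂ x) (inj₂ y) = LineEdge x y

    Link? : ∀ a b → Dec (Link a b)
    Link? (inj₁ _) _        = no λ ()
    Link? (inj₂ x) (inj₁ a) = any? λ i → at x i Fin.≟ a
    Link? (inj₂ x) (inj₂ y) = LineEdge? x y

    rank : Place → ℕ
    rank (inj₁ _) = 0
    rank (inj₂ x) = suc (toℕ x)

    link⇒> : ∀ {a b} → Link a b → rank b < rank a
    link⇒> {inj₂ _} {inj₁ _} _    = s≤s z≤n
    link⇒> {inj₂ _} {inj₂ _} link = s≤s (lineEdge⇒> link)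

    -- The outcome "raise" gets the arbitrary label `i₀`; `step-visited` shows that it does not
    -- occur at a missed line when `w u v` lies in every `C j`.
    toAnswer : Fin k → Fin n ⊎ ⊤ → Place
    toAnswer x o = inj₁ (at x ([ id , const i₀ ] o))

    -- Testing the first premise suffices: if it contains `w u v`, the second one must miss it.
    toPremise : Fin k → Fin k → Bool → Place
    toPremise j₁ j₂ inFirst = inj₂ (if inFirst then j₂ else j₁)

    -- The justification is a separate argument so that proofs can match on it; where its link to
    -- `just x` matters, it returns as an equation.
    step : ∀ x → Initial x ⊎ Derived x → Comm (Cube n) (Cube n) Place
    step x (inj₁ _)             = mapComm withQ withP (toAnswer x) (proj₁ (findOrRaise x))
    step x (inj₂ (j₁ , j₂ , _)) = mapComm withQ withP (toPremise j₁ j₂) (proj₁ (decideV j₁))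

    bits-step : ∀ x d → bits (step x d) ≤ t
    bits-step x (inj₁ _) =
      ℕ.≤-trans (ℕ.≤-reflexive (bits-mapComm _ _ _ _)) (proj₁ (proj₂ (findOrRaise x)))
    bits-step x (inj₂ (j₁ , _)) =
      ℕ.≤-trans (ℕ.≤-reflexive (bits-mapComm _ _ _ _)) (proj₁ (proj₂ (decideV j₁)))

    step-linked : ∀ x d → just x ≡ d → ∀ u v → Link (inj₂ x) (run (step x d) u v)
    step-linked x (inj₁ _) _ u v
      rewrite run-mapComm withQ withP (toAnswer x) (proj₁ (findOrRaise x)) u v = _ , refl
    step-linked x (inj₂ (j₁ , j₂ , _)) eq u v
      rewrite run-mapComm withQ withP (toPremise j₁ j₂) (proj₁ (decideV j₁)) u v
      with run (proj₁ (decideV j₁)) (withQ u) (withP v)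
    ... | true  = inj₁ (premise₂ eq)
    ... | false = inj₁ (premise₁ eq)

    -- An answer leaf counts as visited only if its label is valid, so labels are never wrong and
    -- the whole error falls on the strategy.
    Visited : Cube n → Cube n → Place → Bool
    Visited u v (inj₁ a) = KWᵐ u v (label a)
    Visited u v (inj₂ x) = not (line x (w u v))

    step-visited : ∀ {u v} → U u → V v → w u v ∈ ⋂ C → ∀ x → w u v ∉ line x → ∀ d →
                   Visited u v (run (step x d) u v) ≡ true
    step-visited {u} {v} Uu Vv w∈C x w∉x (inj₁ initial)
      rewrite run-mapComm withQ withP (toAnswer x) (proj₁ (findOrRaise x)) u v
      with initial-cases Uu Vv initial
    ... | inj₂ ∈C⇒∈x = contradiction w∉x (∈⇒¬∉ {D = line x} (∈C⇒∈x w∈C))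
    ... | inj₁ above
      -- `above` at `u` itself and `w∉x` are the two premises under which the outcome of task (4) is
      -- guaranteed.
      with run (proj₁ (findOrRaise x)) (withQ u) (withP v)
         | proj₂ (proj₂ (findOrRaise x)) (withQ u) (withP v) (above u (⊑-refl u)) w∉x
    ... | inj₁ i | u∋i , v∌i rewrite label-at x i | u∋i | v∌i = refl
    ... | inj₂ _ | u′ , u⊑u′ , u′∉x = contradiction u′∉x (∈⇒¬∉ {D = line x} (above u′ u⊑u′))
    step-visited {u} {v} Uu Vv w∈C x w∉x (inj₂ (j₁ , j₂ , _ , _ , sound))
      rewrite run-mapComm withQ withP (toPremise j₁ j₂) (proj₁ (decideV j₁)) u v
      with run (proj₁ (decideV j₁)) (withQ u) (withP v)
         | proj₂ (proj₂ (decideV j₁)) (withQ u) (withP v)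
    ... | false | w∉j₁ = cong not (sym w∉j₁)
    ... | true  | w∈j₁ = cong not (¬-not λ w∈j₂ →
      ∈⇒¬∉ {D = line x} (sound (w u v) (sym w∈j₁) w∈j₂) w∉x)

    -- The protocol graph: acyclic, with one source

    next : Cube n → Cube n → Place → Place
    next u v (inj₁ a) = inj₁ a
    next u v (inj₂ x) = run (step x (just x)) u v

    edge : Fin (L + k) → Fin (L + k) → Bool
    edge x y = does (Link? (place x) (place y))

    edge⇒link : ∀ {x y} → edge x y ≡ true → Link (place x) (place y)
    edge⇒link {x} {y} = does-true (Link? (place x) (place y))

    edge-to-join : ∀ x b → Link (place x) b → edge x (join L k b) ≡ true
    edge-to-join x b link rewrite splitAt-join L k b = dec-true (Link? (place x) b) link

    edge-from-join : ∀ a y → Link a (place y) → edge (join L k a) y ≡ true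
    edge-from-join a y link rewrite splitAt-join L k a = dec-true (Link? a (place y)) link

    path⇒> : ∀ {x y} → TransClosure (λ x y → edge x y ≡ true) x y → rank (place y) < rank (place x)
    path⇒> {x} {y} (edge⁺ x∼y) = link⇒> {place x} {place y} (edge⇒link x∼y)
    path⇒> {x} (_∷_ {y = y} x∼y path) =
      ℕ.<-trans (path⇒> path) (link⇒> {place x} {place y} (edge⇒link x∼y))

    last-source : ∀ a → ¬ Link a (inj₂ last)
    last-source (inj₂ x) (inj₁ premise)           = ℕ.<⇒≱ (premise⇒< premise) (≤-last x)
    last-source (inj₂ x) (inj₂ (_ , last≢last , _)) = last≢last refl

    link-into : ∀ b → b ≢ inj₂ last → ∃ λ a → Link a b
    link-into (inj₁ a) _ with x , at-x ← at-surjective a = inj₂ x , at-x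
    link-into (inj₂ y) y≢last with x , x∼y ← lineEdge-into (y≢last ∘ cong inj₂) = inj₂ x , x∼y

    source⇒last : ∀ x → (∀ y → ¬ edge y x ≡ true) → place x ≡ inj₂ last
    source⇒last x source with ≡-dec Fin._≟_ Fin._≟_ (place x) (inj₂ last)
    ... | yes x≡last = x≡last
    ... | no  x≢last with a , link ← link-into (place x) x≢last =
      contradiction (edge-from-join a x link) (source _)

    isAnswer : Pred Place 0ℓ
    isAnswer a = ∃ λ i → a ≡ inj₁ i

    answer⇒leaf : ∀ x → isAnswer (place x) → ∀ y → ¬ edge x y ≡ true
    answer⇒leaf x (_ , eq) y x∼y = subst (λ a → ¬ Link a (place y)) (sym eq) (λ ()) (edge⇒link x∼y)

    link-next : ∀ a → ¬ isAnswer a → ∀ u v → Link a (next u v a)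
    link-next (inj₁ i) inner u v = contradiction (i , refl) inner
    link-next (inj₂ x) _     u v = step-linked x (just x) refl u v

    inner⇒edge : ∀ x → ¬ isAnswer (place x) → ∀ u v → edge x (join L k (next u v (place x))) ≡ true
    inner⇒edge x inner u v = edge-to-join x _ (link-next (place x) inner u v)

    isAnswer? : Decidable isAnswer
    isAnswer? (inj₁ i) = yes (i , refl)
    isAnswer? (inj₂ _) = no λ ()

    leaf⇒answer : ∀ x → (∀ y → ¬ edge x y ≡ true) → isAnswer (place x)
    leaf⇒answer x leaf with isAnswer? (place x)
    ... | yes answered = answered
    -- The strategy follows a link for all inputs, inside U × V or not, so any word `u₀` exhibits an
    -- outgoing edge.
    ... | no  inner    = contradiction (inner⇒edge x inner u₀ u₀) (leaf _)
      where u₀ = replicate n true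

    protocol : Protocol U V (Fin n)
    protocol = record
      { size        = L + k
      ; edge        = edge
      ; acyclic     = λ x path → ℕ.<-irrefl refl (path⇒> path)
      ; root        = join L k (inj₂ last)
      ; root-source = λ x x∼root → last-source (place x)
          (subst (Link (place x)) (splitAt-join L k (inj₂ last)) (edge⇒link x∼root))
      ; root-unique = λ x source →
          place-injective (trans (source⇒last x source) (sym (splitAt-join L k (inj₂ last))))
      ; lab         = λ x → [ label , const i₀ ] (place x)
      ; S           = λ u v x → join L k (next u v (place x))
      ; S-edge      = λ {u} {v} _ _ x inner → inner⇒edge x (inner ∘ answer⇒leaf x) u v
      ; F           = λ u v x → Visited u v (place x)
      ; root∈F      = λ {u} {v} _ _ →
          trans (cong (Visited u v) (splitAt-join L k (inj₂ last))) (cong not (last-∉ (w u v)))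
      }

    open Protocol protocol using (Comm≤; Tree; TreeUpToLeaves; StrategyFails; LabelWrong)

    -- Communication, error and tree-likeness

    -- The factor 2 arises here: an answer leaf costs one bit from each player, which fits into
    -- `2 * t` because `1 ≤ t`.
    decideVisited : ∀ a → 1 ≤ t → Solvable (2 * t) (λ u v o → o ≡ Visited u v a)
    decideVisited (inj₁ a) 1≤t =
        alice (λ u → lookup u i) (λ b → bob (λ v → lookup v i) (λ c → answer (b ∧ not c)))
      , ℕ.*-monoʳ-≤ 2 1≤t
      , λ _ _ → refl
      where i = label a
    decideVisited (inj₂ x) _ =
        mapComm withQ withP not (proj₁ (decideV x))
      , ℕ.≤-trans (ℕ.≤-reflexive (bits-mapComm _ _ _ _))
                  (ℕ.≤-trans (proj₁ (proj₂ (decideV x))) (ℕ.m≤m+n t _))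
      , λ u v → trans (run-mapComm withQ withP not (proj₁ (decideV x)) u v)
                      (cong not (proj₂ (proj₂ (decideV x)) (withQ u) (withP v)))

    decideNext : ∀ a → Solvable (2 * t) (λ u v o → o ≡ join L k (next u v a))
    decideNext (inj₁ a) = answer _ , z≤n , λ _ _ → refl
    decideNext (inj₂ x) =
        mapComm id id (join L k) (step x (just x))
      , ℕ.≤-trans (ℕ.≤-reflexive (bits-mapComm _ _ _ _))
                  (ℕ.≤-trans (bits-step x (just x)) (ℕ.m≤m+n t _))
      , run-mapComm id id (join L k) (step x (just x))

    protocol-Comm≤ : 1 ≤ t → Comm≤ (2 * t)
    protocol-Comm≤ 1≤t x
      with Π , short , correct ← decideVisited (place x) 1≤t
         | Π′ , short′ , correct′ ← decideNext (place x)
      = (Π , short , λ u v _ _ → correct u v) , λ _ → Π′ , short′ , λ u v _ _ → correct′ u v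

    next-visited : ∀ {u v} → U u → V v → w u v ∈ ⋂ C → ∀ a →
                   Visited u v a ≡ true → Visited u v (next u v a) ≡ true
    next-visited Uu Vv w∈C (inj₁ a) visited = visited
    next-visited Uu Vv w∈C (inj₂ x) visited =
      step-visited Uu Vv w∈C x (not-injective visited) (just x)

    fails⇒∉ : ∀ {u v} → U u → V v → StrategyFails u v → w u v ∉ ⋂ C
    fails⇒∉ {u} {v} Uu Vv (x , _ , visited , lost) = ¬-not λ w∈C →
      contradiction (trans (sym (next-visited Uu Vv w∈C (place x) visited))
        (trans (cong (Visited u v) (sym (splitAt-join L k (next u v (place x))))) lost)) λ ()

    label-correct : ∀ {u v} → ¬ LabelWrong KWᵐ u v
    label-correct {u} {v} (x , leaf , visited , wrong) with place x | leaf⇒answer x leaf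
    ... | _ | i , refl with () ← trans (sym visited) wrong

    treeUpToLeaves : TreeLike → TreeUpToLeaves
    treeUpToLeaves tree x inner y z y∼x z∼x = place-injective
      (unique (place x) (inner ∘ answer⇒leaf x) (place y) (place z) (edge⇒link y∼x) (edge⇒link z∼x))
      where
      unique : ∀ c → ¬ isAnswer c → ∀ a b → Link a c → Link b c → a ≡ b
      unique (inj₁ i) inner _ _ _ _ = contradiction (i , refl) inner
      unique (inj₂ _) _ (inj₂ _) (inj₂ _) link link′ = cong inj₂ (lineEdge-unique tree link link′)

    tree : (∀ x i x′ i′ → at x i ≡ at x′ i′ → x ≡ x′) → TreeLike → Tree
    tree at-injective treeLike x y z y∼x z∼x = place-injective
      (unique (place x) (place y) (place z) (edge⇒link y∼x) (edge⇒link z∼x))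
      where
      unique : ∀ c a b → Link a c → Link b c → a ≡ b
      unique (inj₁ _) (inj₂ _) (inj₂ _) (i , at≡) (i′ , at≡′) =
        cong inj₂ (at-injective _ i _ i′ (trans at≡ (sym at≡′)))
      unique (inj₂ _) (inj₂ _) (inj₂ _) link link′ = cong inj₂ (lineEdge-unique treeLike link link′)

  -- One leaf per label, common to all lines: `n + k` nodes. For surjectivity any line can serve as
  -- parent, here `last`.
  module Shared = Walk {n} (λ _ i → i) id (λ _ _ → refl) (λ i → last , i , refl)

  -- Each line owns `n` leaves, numbered by the pair of line and label; this makes the graph a
  -- genuine tree with `k * n + k` nodes.
  module Split = Walk {k * n} combine (remainder {k} n)
    (λ x i → cong proj₂ (remQuot-combine x i)) combine-surjective

-- Monotonicity of probability and the error bound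

module _ {c ℓ₁ ℓ₂} (K : OrderedRing c ℓ₁ ℓ₂) where
  open OrderedRing K
  open IsPartialOrder isPartialOrder using () renaming (refl to ≼-refl; trans to ≼-trans)

  sum-mono : ∀ {N} {f g : Fin N → Carrier} → (∀ i → f i ≼ g i) → sum f ≼ sum g
  sum-mono {zero}  f≼g = ≼-refl
  sum-mono {suc N} f≼g = ⊕-mono-≼ (f≼g zero) (sum-mono (f≼g ∘ suc))

  module _ (𝒮 : ProbabilitySpace K) where
    open ProbabilitySpace 𝒮

    Prob-mono : ∀ {a b} {P : Pred Ω a} {Q : Pred Ω b} (P? : Decidable P) (Q? : Decidable Q) →
                (∀ ω → P ω → Q ω) → Prob P? ≼ Prob Q?
    Prob-mono P? Q? P⊆Q = sum-mono λ ω → term (P? ω) (Q? ω) ω (P⊆Q ω)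
      where
      term : ∀ {a b} {P : Set a} {Q : Set b} (P? : Dec P) (Q? : Dec Q) ω → (P → Q) →
             (if does P? then weight ω else 0#) ≼ (if does Q? then weight ω else 0#)
      term (yes _)  (yes _)  ω _   = ≼-refl
      term (yes p)  (no ¬q)  ω p⇒q = contradiction (p⇒q p) ¬q
      term (no _)   (yes _)  ω _   = nonNegative ω
      term (no _)   (no _)   ω _   = ≼-refl

    module _ {n} (U V : Pred (Cube n) 0ℓ) (sample : Ω → Protocol U V (Fin n)) where

      randomized : RandomizedProtocol K U V (Fin n)
      randomized = record { space = 𝒮 ; sample = sample }

      -- Both bad events imply that the single point `w u v`, fixed before sampling, is missed by
      -- the intersection of the `C ω`; the approximation bounds that probability.
      error≤ : ∀ {N e ε} (C : Ω → Vector (Subset N) e) (w : Cube n → Cube n → Cube N) →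
        Approximates K 𝒮 ε (λ ω → ⋂ (C ω)) full →
        (∀ ω {u v} → U u → V v → Protocol.StrategyFails (sample ω) u v → w u v ∉ ⋂ (C ω)) →
        (∀ ω {u v} → U u → V v → Protocol.LabelWrong (sample ω) KWᵐ u v → w u v ∉ ⋂ (C ω)) →
        RandomizedProtocol.Error≤ randomized KWᵐ ε
      error≤ C w approx fails⇒∉ wrong⇒∉ {u} {v} Uu Vv =
          ≼-trans (Prob-mono (λ ω → Protocol.strategyFails? (sample ω) u v) missed?
                    λ ω fails → cong not (fails⇒∉ ω Uu Vv fails)) (approx (w u v))
        , ≼-trans (Prob-mono (λ ω → Protocol.labelWrong? (sample ω) KWᵐ u v) missed?
                    λ ω wrong → cong not (wrong⇒∉ ω Uu Vv wrong)) (approx (w u v))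
        where
        missed? : Decidable (λ ω → w u v ∈ (full △ ⋂ (C ω)))
        missed? ω = (full △ ⋂ (C ω)) (w u v) Bool.≟ true

theorem2p5 :
  ∀ {c ℓ₁ ℓ₂} →
  ∃ λ (const : ℕ) →
  (K : OrderedRing c ℓ₁ ℓ₂) →
  let open OrderedRing K in
  (n s r : ℕ) → 1 ≤ n + s + r → 1 ≤ n →
  (m ℓ : ℕ) (A : Vector (Subset (n + s)) m) (B : Vector (Subset (n + r)) ℓ) →
  let U = Proj s A
      V = Proj r B
  in
  ((u : Cube n) → U u → ¬ V u) →
  ((u u′ : Cube n) (b : Cube s) → (u ++ b) ∈ ⋂ A → u ⊑ u′ → (u′ ++ b) ∈ ⋂ A) →
  (e : ℕ) → 1 ≤ e → (ε : Carrier) → 0# ≺ ε →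
  (𝒮 : ProbabilitySpace K) →
  let open ProbabilitySpace 𝒮 in
  (C : Ω → Vector (Subset (n + s + r)) e) →
  Approximates K 𝒮 ε (λ ω → ⋂ (C ω)) full →
  (k t : ℕ) →
  (π : ∀ ω → Refutation ((λ j → cylA n s r (A j)) ⧺ ((λ j → cylB n s r (B j)) ⧺ C ω)) k) →
  (∀ ω (i : Fin k) → MCC≤ n s r (Refutation.line (π ω) i) t) →
  Σ (RandomizedProtocol K U V (Fin n)) λ P →
    RandomizedProtocol.Size≤ P (k + n + e) ×
    RandomizedProtocol.Size≤ P (2 * k + n) ×
    RandomizedProtocol.Communication≤ P (const * t) ×
    RandomizedProtocol.Error≤ P KWᵐ ε ×
    ((∀ ω → Refutation.TreeLike (π ω)) →
      RandomizedProtocol.AllTreeUpToLeaves P ×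
      Σ (RandomizedProtocol K U V (Fin n)) λ Q →
        RandomizedProtocol.AllTree Q ×
        RandomizedProtocol.Size≤ Q (k + k * n) ×
        RandomizedProtocol.Communication≤ Q (const * t) ×
        RandomizedProtocol.Error≤ Q KWᵐ ε)
theorem2p5 = 2 , λ K n s r _ 1≤n m ℓ A B _ monotone e 1≤e ε _ 𝒮 C approx → λ where
  -- With no bits available the one-node protocol is used; it is a tree, so `P` also serves as `Q`.
  k zero π mcc →
    let module I ω = Interpolation A B monotone (C ω) (π ω) zero (mcc ω) (fromℕ< 1≤n)
        w = λ (u v : Cube n) → (v ++ extension A u) ++ extension B v
        P = randomized K 𝒮 (Proj s A) (Proj r B) I.trivialProtocol
        error = error≤ K 𝒮 (Proj s A) (Proj r B) I.trivialProtocol C w approx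
          (λ { ω Uu Vv (_ , _ , _ , ()) }) (λ ω Uu Vv _ → I.silent⇒∉ ω refl Uu Vv)
        -- A refutation has a last line, so `k` is positive.
        1≤k = λ ω → ℕ.≤-trans (s≤s z≤n) (toℕ<n (Lines.last (π ω)))
    in P
     , (λ _ → ℕ.≤-trans 1≤e (ℕ.m≤n+m e (k + n)))
     , (λ _ → ℕ.≤-trans 1≤n (ℕ.m≤n+m n (2 * k)))
     , (λ ω → I.trivial-Comm≤ ω)
     , error
     , λ _ → (λ _ _ _ _ _ ())
           , P , (λ _ _ _ _ ()) , (λ ω → ℕ.≤-trans (1≤k ω) (ℕ.m≤m+n k (k * n)))
           , (λ ω → I.trivial-Comm≤ ω) , error
  k t@(suc _) π mcc →
    let module I ω = Interpolation A B monotone (C ω) (π ω) t (mcc ω) (fromℕ< 1≤n)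
        w = λ (u v : Cube n) → (v ++ extension A u) ++ extension B v
    in randomized K 𝒮 (Proj s A) (Proj r B) I.Shared.protocol
     , (λ _ → ℕ.≤-trans (ℕ.≤-reflexive (ℕ.+-comm n k)) (ℕ.m≤m+n (k + n) e))
     , (λ _ → ℕ.≤-trans (ℕ.≤-reflexive (ℕ.+-comm n k)) (ℕ.+-monoˡ-≤ n (ℕ.m≤m+n k _)))
     , (λ ω → I.Shared.protocol-Comm≤ ω (s≤s z≤n))
     , error≤ K 𝒮 (Proj s A) (Proj r B) I.Shared.protocol C w approx
         I.Shared.fails⇒∉ (λ ω _ _ wrong → contradiction wrong (I.Shared.label-correct ω))
     , λ treeLike → (λ ω → I.Shared.treeUpToLeaves ω (treeLike ω))
         , randomized K 𝒮 (Proj s A) (Proj r B) I.Split.protocol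
         , (λ ω → I.Split.tree ω combine-injectiveˡ (treeLike ω))
         , (λ _ → ℕ.≤-reflexive (ℕ.+-comm (k * n) k))
         , (λ ω → I.Split.protocol-Comm≤ ω (s≤s z≤n))
         , error≤ K 𝒮 (Proj s A) (Proj r B) I.Split.protocol C w approx
             I.Split.fails⇒∉ (λ ω _ _ wrong → contradiction wrong (I.Split.label-correct ω))
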